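{- Let $\mathrm{N}_1 = \mathrm{nM}([2,4,5,6,8,8])$. Then $\mathrm{N}_1(k) = \mathrm{N}(k)$ for all $k \in \mathbb{N} \setminus \{2^m - m + 1 : m \in \mathbb{N}, m \ge 3\}$, while for $k = 2^m - m + 1$ with $m \in \mathbb{N}$, $m \ge 3$, we have $\mathrm{N}_1(k) = \mathrm{N}(k) - 1 = 2^m$.
   Context: $\mathrm{N} : \mathbb{N} \to \mathbb{N}$ is defined by $\mathrm{N}(1) = 2$ and $\mathrm{N}(k) = \max_{i \in \{2,\dots,k\}} \min(2i, \mathrm{N}(k-i+1)+i)$ for $k \ge 2$. $[2,4,5,6,8,8]$ denotes the function $f : \mathbb{N} \to \mathbb{N} \cup \{+\infty\}$ with $(f(1),\dots,f(6)) = (2,4,5,6,8,8)$ and $f(k) = +\infty$ for $k \ge 7$. For $g : \mathbb{N} \to \mathbb{N} \cup \{+\infty\}$ and $k \ge 2$, $m \ge 4$, $\mathrm{pdp}_g(k,m)$ is the set of pairs $(e_0,e_1) \in \mathbb{N}^2$ with (i) $e_0,e_1 \ge 2$; (ii) $e_0,e_1 \le k$; (iii) $e_0+e_1 = m$; (iv) $e_0 \le e_1$; (v) $g(k-e_\varepsilon+1)+e_\varepsilon \ge m$ for both $\varepsilon \in \{0,1\}$. For $f$ with $f(1) = 2$, $f' = \mathrm{nM}(f)$ is defined by $f'(1) = 2$ and, for $k > 1$, $f'(k) = \min(m, f(k))$ where $m$ is the largest integer in $\{4,\dots,2k\}$ with $\mathrm{pdp}_{f'}(k,m) \ne \emptyset$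 (this uses only $f'(k')$ for $k' < k$). -}

module Defs where

open import Data.List.Base using (List; []; _∷_; map; filter; applyUpTo)
open import Data.List.Extrema.Nat using (max; ⊥≤max)
open import Data.List.Properties using (map-cong-local; filter-≐)
open import Data.List.Relation.Unary.All as All using (All)
open import Data.List.Relation.Unary.All.Properties using (applyUpTo⁺₁)
import Data.Maybe.Base as Maybe
open import Data.Nat.Base
  using (ℕ; zero; suc; _+_; _*_; _∸_; _⊓_; _≤_; _<_; s≤s)
open import Data.Nat.Properties
  using (_≟_; _≤?_; anyUpTo?; ≤-refl; ≤-trans; <-≤-trans; m≤m+n; m+n∸m≡n;
         +-comm; +-monoʳ-<; +-monoˡ-≤; m∸n+n≡m; ⊓-glb; module ≤-Reasoning)
open import Data.Product.Base using (∃-syntax; _×_; _,_)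
open import Function.Base using (_∘_)
open import Level using (0ℓ)
open import Relation.Binary.PropositionalEquality
  using (_≡_; refl; sym; cong; subst)
open import Relation.Nullary.Construct.Add.Supremum using (_⁺; ⊤⁺; [_])
open import Relation.Binary.Construct.Add.Supremum.NonStrict _≤_
  using (_≤⁺_; [_]; ≤⁺-dec)
open import Relation.Nullary.Decidable.Core using (Dec; map′; _×-dec_)
open import Relation.Unary using (Pred; Satisfiable)

-- Throughout, the mathematical functions have domain {1, 2, 3, …}; they are
-- encoded as functions on ℕ whose value at 0 is junk and is never consulted.

ℕ∞ : Set
ℕ∞ = ℕ ⁺

infixl 6 _+∞_
infixl 7 _⊓∞_

_+∞_ : ℕ∞ → ℕ → ℕ∞
x +∞ n = Maybe.map (_+ n) x

_⊓∞_ : ℕ → ℕ∞ → ℕ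
m ⊓∞ [ n ] = m ⊓ n
m ⊓∞ ⊤⁺    = m

-- The list a, a + 1, …, b (empty if b < a).
[_⋯_] : ℕ → ℕ → List ℕ
[ a ⋯ b ] = applyUpTo (a +_) (suc b ∸ a)

------------------------------------------------------------------------
-- Course-of-values recursion.  F g k is the value at k computed from the
-- earlier values g; when F g k only looks at g j for j < k, the function
-- recurse F is the solution of r k = F r k (lemma recurse-unfold).

iterate : ((ℕ → ℕ) → ℕ → ℕ) → ℕ → ℕ → ℕ
iterate F zero    = λ _ → 0
iterate F (suc n) = F (iterate F n)

recurse : ((ℕ → ℕ) → ℕ → ℕ) → ℕ → ℕ
recurse F k = iterate F (suc k) k

Causal : ((ℕ → ℕ) → ℕ → ℕ) → Set
Causal F = ∀ {g h} k → (∀ j → j < k → g j ≡ h j) → F g k ≡ F h k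

recurse-unfold : ∀ {F} → Causal F → ∀ k → recurse F k ≡ F (recurse F) k
recurse-unfold {F} c k = c k (λ j j<k → stable j k (suc j) j<k ≤-refl)
  where
  stable : ∀ j m n → j < m → j < n → iterate F m j ≡ iterate F n j
  stable j (suc m) (suc n) (s≤s j≤m) (s≤s j≤n) =
    c j (λ i i<j → stable i m n (<-≤-trans i<j j≤m) (<-≤-trans i<j j≤n))

------------------------------------------------------------------------

N-step : (ℕ → ℕ) → ℕ → ℕ
N-step N 0               = 0
N-step N 1               = 2
N-step N k@(suc (suc _)) =
  max 0 (map (λ i → (2 * i) ⊓ (N (k ∸ i + 1) + i)) [ 2 ⋯ k ])

N : ℕ → ℕ
N = recurse N-step

-- ⟦ a₁ ∷ … ∷ aₙ ∷ [] ⟧ has value aₖ at k for 1 ≤ k ≤ n and +∞ for k > n.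
⟦_⟧ : List ℕ → ℕ → ℕ∞
⟦ _      ⟧ zero          = ⊤⁺
⟦ []     ⟧ (suc _)       = ⊤⁺
⟦ x ∷ xs ⟧ 1             = [ x ]
⟦ x ∷ xs ⟧ (suc (suc k)) = ⟦ xs ⟧ (suc k)

pdp : (ℕ → ℕ∞) → ℕ → ℕ → Pred (ℕ × ℕ) 0ℓ
pdp g k m (e₀ , e₁) =
    (2 ≤ e₀ × 2 ≤ e₁)
  × (e₀ ≤ k × e₁ ≤ k)
  × e₀ + e₁ ≡ m
  × e₀ ≤ e₁
  × ([ m ] ≤⁺ g (k ∸ e₀ + 1) +∞ e₀ × [ m ] ≤⁺ g (k ∸ e₁ + 1) +∞ e₁)

pdp-nonempty? : ∀ g k m → Dec (Satisfiable (pdp g k m))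
pdp-nonempty? g k m = map′ to from (anyUpTo? inner? (suc m))
  where
  pdp? : ∀ e₀ e₁ → Dec (pdp g k m (e₀ , e₁))
  pdp? e₀ e₁ =
    ((2 ≤? e₀) ×-dec (2 ≤? e₁)) ×-dec ((e₀ ≤? k) ×-dec (e₁ ≤? k))
    ×-dec (e₀ + e₁ ≟ m) ×-dec (e₀ ≤? e₁)
    ×-dec (≤⁺-dec _≤?_ [ m ] (g (k ∸ e₀ + 1) +∞ e₀)
           ×-dec ≤⁺-dec _≤?_ [ m ] (g (k ∸ e₁ + 1) +∞ e₁))

  inner? : ∀ e₀ → Dec (pdp g k m (e₀ , m ∸ e₀))
  inner? e₀ = pdp? e₀ (m ∸ e₀)

  to : (∃[ e₀ ] e₀ < suc m × pdp g k m (e₀ , m ∸ e₀)) → Satisfiable (pdp g k m)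
  to (e₀ , _ , p) = (e₀ , m ∸ e₀) , p

  from : Satisfiable (pdp g k m) → ∃[ e₀ ] e₀ < suc m × pdp g k m (e₀ , m ∸ e₀)
  from ((e₀ , e₁) , p@(_ , _ , refl , _)) =
    e₀ , s≤s (m≤m+n e₀ e₁) ,
    subst (λ e → pdp g k m (e₀ , e)) (sym (m+n∸m≡n e₀ e₁)) p

-- The default 4 is taken only if no m ∈ {4, …, 2k} qualifies.  That cannot
-- happen if f k ≥ 2 for all k ≥ 2 (lemma pdp-4-nonempty).
largest : (ℕ → ℕ∞) → ℕ → ℕ
largest g k = max 4 (filter (pdp-nonempty? g k) [ 4 ⋯ 2 * k ])

-- Since f′ k is a minimum with the integer m, nM f is finite-valued.
nM-step : (ℕ → ℕ∞) → (ℕ → ℕ) → ℕ → ℕ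
nM-step f f′ 0               = 0
nM-step f f′ 1               = 2
nM-step f f′ k@(suc (suc _)) = largest ([_] ∘ f′) k ⊓∞ f k

nM : (ℕ → ℕ∞) → ℕ → ℕ
nM f = recurse (nM-step f)

------------------------------------------------------------------------
-- The defining recursions of N and nM.

private
  earlier : ∀ {e k} → 2 ≤ e → e ≤ k → k ∸ e + 1 < k
  earlier {e} {k} 2≤e e≤k = begin-strict
    k ∸ e + 1 <⟨ +-monoʳ-< (k ∸ e) 2≤e ⟩
    k ∸ e + e ≡⟨ m∸n+n≡m e≤k ⟩
    k         ∎
    where open ≤-Reasoning

  [2⋯_]-bounds : ∀ k → All (λ i → 2 ≤ i × i ≤ suc k) [ 2 ⋯ suc k ]
  [2⋯ k ]-bounds = applyUpTo⁺₁ (2 +_) k (λ {i} i<k → m≤m+n 2 i , s≤s i<k)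

  N-causal : Causal N-step
  N-causal 0               eq = refl
  N-causal 1               eq = refl
  N-causal k@(suc (suc k′)) eq = cong (max 0) (map-cong-local
    (All.map (λ {i} (2≤i , i≤k) → cong (λ x → (2 * i) ⊓ (x + i)) (eq _ (earlier 2≤i i≤k)))
             [2⋯ suc k′ ]-bounds))

  pdp-causal : ∀ {g h : ℕ → ℕ∞} {k m} → (∀ j → j < k → g j ≡ h j) →
               ∀ {p} → pdp g k m p → pdp h k m p
  pdp-causal {m = m} eq {e₀ , e₁} (two@(2≤e₀ , 2≤e₁) , le@(e₀≤k , e₁≤k) , sum , ord , b₀ , b₁) =
    two , le , sum , ord ,
    subst (λ x → [ m ] ≤⁺ x +∞ e₀) (eq _ (earlier 2≤e₀ e₀≤k)) b₀ ,
    subst (λ x → [ m ] ≤⁺ x +∞ e₁) (eq _ (earlier 2≤e₁ e₁≤k)) b₁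

  nM-causal : ∀ f → Causal (nM-step f)
  nM-causal f 0               eq = refl
  nM-causal f 1               eq = refl
  nM-causal f k@(suc (suc _)) eq = cong (λ ms → max 4 ms ⊓∞ f k)
    (filter-≐ _ _
      ( (λ (p , q) → p , pdp-causal (λ j j<k → cong [_] (eq j j<k)) q)
      , (λ (p , q) → p , pdp-causal (λ j j<k → cong [_] (sym (eq j j<k))) q))
      [ 4 ⋯ 2 * k ])

N-unfold : ∀ k → N k ≡ N-step N k
N-unfold = recurse-unfold N-causal

nM-unfold : ∀ f k → nM f k ≡ nM-step f (nM f) k
nM-unfold f = recurse-unfold (nM-causal f)

pdp-4-nonempty : ∀ f → (∀ k → 2 ≤ k → [ 2 ] ≤⁺ f k) →
                 ∀ k → 2 ≤ k → Satisfiable (pdp ([_] ∘ nM f) k 4)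
pdp-4-nonempty f 2≤f 1 (s≤s ())
pdp-4-nonempty f 2≤f k@(suc (suc k′)) 2≤k =
  (2 , 2) , (≤-refl , ≤-refl) , (2≤k , 2≤k) , refl , ≤-refl , (bound , bound)
  where
  2≤⊓∞ : ∀ {m} x → 2 ≤ m → [ 2 ] ≤⁺ x → 2 ≤ m ⊓∞ x
  2≤⊓∞ [ _ ] p [ q ] = ⊓-glb p q
  2≤⊓∞ ⊤⁺    p _     = p

  4≤largest : ∀ g n → 4 ≤ largest g n
  4≤largest g n = ⊥≤max 4 (filter (pdp-nonempty? g n) [ 4 ⋯ 2 * n ])

  2≤step : ∀ n → 2 ≤ nM-step f (nM f) (suc n)
  2≤step zero    = ≤-refl
  2≤step (suc n) = 2≤⊓∞ (f (2 + n))
    (≤-trans (m≤m+n 2 2) (4≤largest ([_] ∘ nM f) (2 + n)))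
    (2≤f (2 + n) (m≤m+n 2 n))

  2≤nM : ∀ n → 2 ≤ nM f (n + 1)
  2≤nM n = subst (λ i → 2 ≤ nM f i) (+-comm 1 n)
    (subst (2 ≤_) (sym (nM-unfold f (suc n))) (2≤step n))

  bound : [ 4 ] ≤⁺ [ nM f (k′ + 1) + 2 ]
  bound = [ +-monoˡ-≤ 2 (2≤nM k′) ]

{-# OPTIONS --safe #-}
-- Write a candidate value at k as k + q.  A pair (e₀ , e₁) with sum k + q then
-- passes condition (v) iff e₁ = (k − e₀ + 1) + (q − 1) is attained at k − e₀ + 1
-- and e₀ = (k − e₁ + 1) + (q − 1) is attained at k − e₁ + 1.  So "k + q ≤ N₁ k"
-- depends on (k + q , q) only, and holds iff k + q is a sum of two numbers
-- admissible for q − 1.  Starting from the initial values this gives: s is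
-- admissible for q iff s ≥ 2 ^ q and, once q ≥ 3, s ≠ 2 ^ q + 1; the exclusion
-- at q = 3 is the cap f(6) = 8, and it propagates because the only splitting of
-- 2 ^ (q + 1) + 1 into parts ≥ 2 ^ q is 2 ^ q + (2 ^ q + 1).  For N the part
-- e₁ ≥ m / 2 need not be attained, and only the condition s ≥ 2 ^ q remains.
module Submission where

open import Defs
open import Data.List.Base using (List; []; _∷_; length)
open import Data.List.Extrema.Nat using (max<v⁺; v≤max⁺)
open import Data.List.Membership.Propositional using (_∈_; lose)
open import Data.List.Membership.Propositional.Properties
  using (∈-applyUpTo⁺; ∈-filter⁺)
import Data.List.Relation.Unary.All as All
import Data.List.Relation.Unary.All.Properties as All
import Data.List.Relation.Unary.Any.Properties as Any
open import Data.Nat.Base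
  using (ℕ; zero; suc; _+_; _*_; _∸_; _^_; _⊓_; _≤_; _<_; _≤′_; ≤′-refl;
         ≤′-step; z≤n; s≤s; z<s)
open import Data.Nat.Induction using (<-rec)
open import Data.Nat.Properties
open import Data.Product.Base using (_×_; ∃-syntax; _,_)
open import Data.Sum.Base using (_⊎_; inj₁; inj₂)
open import Function.Base using (_∘_)
open import Relation.Binary.Construct.Add.Supremum.NonStrict _≤_ using ([_])
open import Relation.Binary.Definitions using (tri<; tri≈; tri>)
open import Relation.Binary.PropositionalEquality
  using (_≡_; _≢_; refl; sym; trans; cong; subst; subst₂)
open import Relation.Nullary using (¬_; yes; no; contradiction)
open import Relation.Nullary.Construct.Add.Supremum using (⊤⁺; [_])
open import Relation.Nullary.Decidable using (from-yes; ¬?; _→-dec_)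
open import Relation.Unary using (Satisfiable)

private
  caps : List ℕ
  caps = 2 ∷ 4 ∷ 5 ∷ 6 ∷ 8 ∷ 8 ∷ []

  N₁ : ℕ → ℕ
  N₁ = nM ⟦ caps ⟧

-- Growth of powers of two.

2^[1+n]≡2^n+2^n : ∀ n → 2 ^ suc n ≡ 2 ^ n + 2 ^ n
2^[1+n]≡2^n+2^n n = cong (2 ^ n +_) (+-identityʳ (2 ^ n))

m<2^n⇒1+m<2^[1+n] : ∀ {m} n → m < 2 ^ n → suc m < 2 ^ suc n
m<2^n⇒1+m<2^[1+n] {m} n m<2^n = begin-strict
  suc m         ≤⟨ m<2^n ⟩
  2 ^ n         <⟨ m<n+m (2 ^ n) (m^n>0 2 n) ⟩
  2 ^ n + 2 ^ n ≡⟨ 2^[1+n]≡2^n+2^n n ⟨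
  2 ^ suc n     ∎
  where open ≤-Reasoning

m<2^n⇒o+m<2^[o+n] : ∀ {m} n o → m < 2 ^ n → o + m < 2 ^ (o + n)
m<2^n⇒o+m<2^[o+n] n zero    m<2^n = m<2^n
m<2^n⇒o+m<2^[o+n] n (suc o) m<2^n =
  m<2^n⇒1+m<2^[1+n] (o + n) (m<2^n⇒o+m<2^[o+n] n o m<2^n)

n<2^n : ∀ n → n < 2 ^ n
n<2^n zero    = z<s
n<2^n (suc n) = m<2^n⇒1+m<2^[1+n] n (n<2^n n)

2+2^n<2^[1+n] : ∀ {n} → 3 ≤ n → 2 + 2 ^ n < 2 ^ suc n
2+2^n<2^[1+n] {n} 3≤n = subst (2 + 2 ^ n <_) (sym (2^[1+n]≡2^n+2^n n))
  (+-monoˡ-< (2 ^ n) (<-≤-trans (m≤m+n 3 5) (^-monoʳ-≤ 2 3≤n)))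

-- Arithmetic of splitting a sum into two parts.

-- If k + q + 1 splits as e + e′, then e′ is the same expression k + q for the
-- pair (k ∸ e + 1 , q); so a bound in terms of k + q can be halved.
complement : ∀ {k q e e′} → e ≤ k → e + e′ ≡ k + suc q → k ∸ e + 1 + q ≡ e′
complement {k} {q} {e} {e′} e≤k sum = +-cancelˡ-≡ e (k ∸ e + 1 + q) e′ (begin
  e + (k ∸ e + 1 + q)   ≡⟨ cong (e +_) (+-assoc (k ∸ e) 1 q) ⟩
  e + (k ∸ e + suc q)   ≡⟨ +-assoc e (k ∸ e) (suc q) ⟨
  e + (k ∸ e) + suc q   ≡⟨ cong (_+ suc q) (m+[n∸m]≡n e≤k) ⟩
  k + suc q             ≡⟨ sum ⟨
  e + e′                ∎)
  where open Relation.Binary.PropositionalEquality.≡-Reasoning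

k∸e+1<k : ∀ {e k} → 2 ≤ e → e ≤ k → k ∸ e + 1 < k
k∸e+1<k {e} {k} 2≤e e≤k = begin-strict
  k ∸ e + 1 <⟨ +-monoʳ-< (k ∸ e) 2≤e ⟩
  k ∸ e + e ≡⟨ m∸n+n≡m e≤k ⟩
  k         ∎
  where open ≤-Reasoning

-- Ensures that removing `2 ^ q` from `k + suc q` leaves a part of size at most `k`.
k+1+q≤2^q+k : ∀ k q → k + suc q ≤ 2 ^ q + k
k+1+q≤2^q+k k q = subst (k + suc q ≤_) (+-comm k (2 ^ q)) (+-monoʳ-≤ k (n<2^n q))

-- The threshold for `N`.

≤N : ∀ {k m i} → 2 ≤ i → i ≤ k → m ≤ 2 * i → m ≤ N (k ∸ i + 1) + i → m ≤ N k
≤N {suc zero} (s≤s (s≤s _)) (s≤s ())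
≤N {k@(suc (suc k′))} {m} {suc (suc i)} (s≤s (s≤s _)) (s≤s i<k) m≤ m≤′ =
  subst (m ≤_) (sym (N-unfold k)) (v≤max⁺ 0 _ (inj₂
    (Any.map⁺ (Any.applyUpTo⁺ (2 +_) (⊓-glb m≤ m≤′) i<k))))

N< : ∀ {k m} → 2 ≤ k → 0 < m →
     (∀ {i} → 2 ≤ i → i ≤ k → (2 * i) ⊓ (N (k ∸ i + 1) + i) < m) → N k < m
N< {1} (s≤s ())
N< {k@(suc (suc k′))} {m} _ 0<m below =
  subst (_< m) (sym (N-unfold k)) (max<v⁺ 0<m (All.map⁺
    (All.applyUpTo⁺₁ (2 +_) (suc k′) (λ i<k → below (s≤s (s≤s z≤n)) (s≤s i<k)))))

-- For a positive excess `suc q`, take `i = e₁`, what remains of the sum after removing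
-- `e₀ = 2 ^ q`. Then `2 * e₁` is large enough because `e₀ ≤ e₁`, and the smaller index only has to
-- attain `2 ^ q`, where the induction hypothesis applies with equality.
N-lower : ∀ k → 1 ≤ k → ∀ q → 2 ^ q ≤ k + q → k + q ≤ N k
N-lower = <-rec _ step
  where
  Lower : ℕ → Set
  Lower k = 1 ≤ k → ∀ q → 2 ^ q ≤ k + q → k + q ≤ N k

  positive : ∀ {k} → 2 ≤ k → (∀ {j} → j < k → Lower j) →
             ∀ q → 2 ^ suc q ≤ k + suc q → k + suc q ≤ N k
  positive {k} 2≤k ih q le = ≤N 2≤e₁ e₁≤k
    (≤-trans (≤-reflexive (sym sum)) (≤-trans (+-monoˡ-≤ e₁ e₀≤e₁)
      (≤-reflexive (cong (e₁ +_) (sym (+-identityʳ e₁))))))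
    (≤-trans (≤-reflexive (sym sum)) (+-monoˡ-≤ e₁ e₀≤N))
    where
    e₀ = 2 ^ q
    2e₀≤ : e₀ + e₀ ≤ k + suc q
    2e₀≤ = subst (_≤ k + suc q) (2^[1+n]≡2^n+2^n q) le
    e₁ = k + suc q ∸ e₀
    sum : e₀ + e₁ ≡ k + suc q
    sum = m+[n∸m]≡n (≤-trans (m≤m+n e₀ e₀) 2e₀≤)
    e₀≤e₁ : e₀ ≤ e₁
    e₀≤e₁ = +-cancelˡ-≤ e₀ e₀ e₁ (subst (e₀ + e₀ ≤_) (sym sum) 2e₀≤)
    e₁≤k : e₁ ≤ k
    e₁≤k = m≤n+o⇒m∸n≤o (k + suc q) e₀ (k+1+q≤2^q+k k q)
    2≤e₁ : 2 ≤ e₁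
    2≤e₁ with 2 ≤? e₁
    ... | yes p = p
    -- Otherwise both parts are at most 1, but their sum is at least 3.
    ... | no ¬p = contradiction
      (≤-trans (+-mono-≤ 2≤k (s≤s z≤n)) (subst (_≤ 2) sum
        (+-mono-≤ (≤-trans e₀≤e₁ (≤-pred (≰⇒> ¬p))) (≤-pred (≰⇒> ¬p))))) λ { (s≤s (s≤s ())) }
    j+q≡e₀ : k ∸ e₁ + 1 + q ≡ e₀
    j+q≡e₀ = complement e₁≤k (trans (+-comm e₁ e₀) sum)
    e₀≤N : e₀ ≤ N (k ∸ e₁ + 1)
    e₀≤N = subst (_≤ N (k ∸ e₁ + 1)) j+q≡e₀
      (ih (k∸e+1<k 2≤e₁ e₁≤k) (m≤n+m 1 _) q (≤-reflexive (sym j+q≡e₀)))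

  step : ∀ k → (∀ {j} → j < k → Lower j) → Lower k
  step 1 _ _ 0 _ = s≤s z≤n
  step 1 _ _ 1 _ = s≤s (s≤s z≤n)
  step 1 _ _ (suc (suc q)) le = contradiction le
    (<⇒≱ (subst₂ _<_ (+-comm q 3) (cong (2 ^_) (+-comm q 2))
      (m<2^n⇒o+m<2^[o+n] 2 q ≤-refl)))
  -- The splitting treats positive excess only; excess 0 follows from excess 1.
  step k@(suc (suc k′)) ih _ 0 _ =
    ≤-trans (+-monoʳ-≤ k z≤n) (positive (s≤s (s≤s z≤n)) ih 0 (≤-trans (s≤s (s≤s z≤n)) (m≤m+n k 1)))
  step k@(suc (suc k′)) ih _ (suc q) le = positive (s≤s (s≤s z≤n)) ih q le

-- An index `i` with `2 * i` below the sum fails at once. Otherwise the other part `e` is the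
-- smaller one, hence below `2 ^ q`, and by induction it is not attained.
N-upper : ∀ k → 1 ≤ k → ∀ q → k + q < 2 ^ q → N k < k + q
N-upper = <-rec _ step
  where
  Upper : ℕ → Set
  Upper k = 1 ≤ k → ∀ q → k + q < 2 ^ q → N k < k + q

  step : ∀ k → (∀ {j} → j < k → Upper j) → Upper k
  step 1 _ _ 0 (s≤s ())
  step 1 _ _ 1 (s≤s (s≤s ()))
  step 1 _ _ (suc (suc q)) _ = s≤s (s≤s (s≤s z≤n))
  step (suc (suc k)) _ _ 0 (s≤s ())
  step k@(suc (suc k′)) ih _ (suc q) gap = N< (s≤s (s≤s z≤n)) z<s below
    where
    below : ∀ {i} → 2 ≤ i → i ≤ k → (2 * i) ⊓ (N (k ∸ i + 1) + i) < k + suc q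
    below {i} 2≤i i≤k with 2 * i <? k + suc q
    ... | yes 2i<m = ≤-<-trans (m⊓n≤m _ _) 2i<m
    ... | no  2i≮m = ≤-<-trans (m⊓n≤n (2 * i) _) (subst (N (k ∸ i + 1) + i <_)
            (trans (+-comm e i) sum) (+-monoˡ-< i (subst (N (k ∸ i + 1) <_) j+q≡e
              (ih (k∸e+1<k 2≤i i≤k) (m≤n+m 1 _) q (subst (_< 2 ^ q) (sym j+q≡e) e<2^q)))))
      where
      e = k + suc q ∸ i
      sum : i + e ≡ k + suc q
      sum = m+[n∸m]≡n (≤-trans i≤k (m≤m+n k (suc q)))
      j+q≡e : k ∸ i + 1 + q ≡ e
      j+q≡e = complement i≤k sum
      e≤i : e ≤ i
      e≤i = +-cancelˡ-≤ i e i (subst₂ _≤_ (sym sum) (cong (i +_) (+-identityʳ i)) (≮⇒≥ 2i≮m))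
      e<2^q : e < 2 ^ q
      e<2^q = ≰⇒> λ 2^q≤e → <⇒≱ gap (subst₂ _≤_ (sym (2^[1+n]≡2^n+2^n q)) sum
        (+-mono-≤ (≤-trans 2^q≤e e≤i) 2^q≤e))

-- Obstructions for `N₁` and their behaviour under splitting.

-- Gap (k + q) q is the obstruction to k + q ≤ N₁ k.
Gap : ℕ → ℕ → Set
Gap s q = s < 2 ^ q ⊎ (3 ≤ q × s ≡ 1 + 2 ^ q)

-- The sum grows by one while the power doubles, so an exceptional sum falls below the next power.
Gap-suc : ∀ {s q} → Gap s q → Gap (suc s) (suc q)
Gap-suc {s} {q} (inj₁ s<2^q)        = inj₁ (m<2^n⇒1+m<2^[1+n] q s<2^q)
Gap-suc     {q} (inj₂ (3≤q , refl)) = inj₁ (2+2^n<2^[1+n] 3≤q)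

Gap-≤ : ∀ {k q q′} → q ≤ q′ → Gap (k + q) q → Gap (k + q′) q′
Gap-≤ {k} {q} q≤q′ gap = go (≤⇒≤′ q≤q′)
  where
  go : ∀ {q′} → q ≤′ q′ → Gap (k + q′) q′
  go ≤′-refl              = gap
  go {suc q′} (≤′-step p) = subst (λ s → Gap s (suc q′)) (sym (+-suc k q′)) (Gap-suc (go p))

-- Without a gap in `e₀`, both parts are at least `2 ^ q`. This settles sums below `2 ^ suc q`; the
-- exceptional sum leaves only `2 ^ q` and `1 + 2 ^ q`. The sum 9 at `suc q = 3` is set apart: its
-- part 5 is no gap at 2, since exceptions begin at 3.
Gap-split : ∀ {e₀ e₁ q} → e₀ ≤ e₁ → (suc q ≡ 3 → e₀ + e₁ ≢ 9) →
            Gap (e₀ + e₁) (suc q) → Gap e₀ q ⊎ Gap e₁ q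
Gap-split {e₀} {e₁} {q} e₀≤e₁ _ (inj₁ s<) = inj₁ (inj₁ (≰⇒> λ 2^q≤e₀ →
  <⇒≱ s< (subst (_≤ e₀ + e₁) (sym (2^[1+n]≡2^n+2^n q))
    (+-mono-≤ 2^q≤e₀ (≤-trans 2^q≤e₀ e₀≤e₁)))))
Gap-split {e₀} {e₁} {q} e₀≤e₁ ≢9 (inj₂ (3≤1+q , s≡)) with <-cmp e₀ (2 ^ q)
... | tri< e₀<2^q _ _ = inj₁ (inj₁ e₀<2^q)
... | tri> _ _ 2^q<e₀ = contradiction
  (subst (suc (2 ^ q) + suc (2 ^ q) ≤_) (trans s≡ (cong suc (2^[1+n]≡2^n+2^n q)))
    (+-mono-≤ 2^q<e₀ (≤-trans 2^q<e₀ e₀≤e₁)))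
  (<⇒≱ (s≤s (+-monoʳ-< (2 ^ q) ≤-refl)))
... | tri≈ _ refl _ = inj₂ (inj₂ (3≤q , +-cancelˡ-≡ (2 ^ q) e₁ (1 + 2 ^ q)
  (trans s≡ (trans (cong suc (2^[1+n]≡2^n+2^n q)) (sym (+-suc (2 ^ q) (2 ^ q)))))))
  where
  3≤q : 3 ≤ q
  3≤q = ≤-pred (≤∧≢⇒< 3≤1+q λ 3≡1+q →
    ≢9 (sym 3≡1+q) (trans s≡ (cong (λ n → 1 + 2 ^ n) (sym 3≡1+q))))

-- The recursion of `nM` as inequalities.

largest< : ∀ {g k n} → 4 < n → (∀ {m} → Satisfiable (pdp g k m) → m < n) → largest g k < n
largest< {g} {k} 4<n below = max<v⁺ 4<n
  (All.map below (All.all-filter (pdp-nonempty? g k) [ 4 ⋯ 2 * k ]))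

≤largest : ∀ {g k m} → 4 ≤ m → m ≤ 2 * k → Satisfiable (pdp g k m) → m ≤ largest g k
≤largest {g} {k} {m} 4≤m m≤2k sat = v≤max⁺ 4 _ (inj₂ (lose
  (∈-filter⁺ (pdp-nonempty? g k) (subst (λ n → n ∈ [ 4 ⋯ 2 * k ]) (m+[n∸m]≡n 4≤m)
    (∈-applyUpTo⁺ (4 +_) (∸-monoˡ-< (s≤s m≤2k) 4≤m))) sat) ≤-refl))

⊓∞≤ : ∀ m x → m ⊓∞ x ≤ m
⊓∞≤ m [ n ] = m⊓n≤m m n
⊓∞≤ m ⊤⁺    = ≤-refl

nM≤largest : ∀ f {k} → 2 ≤ k → nM f k ≤ largest ([_] ∘ nM f) k
nM≤largest f {suc zero} (s≤s ())
nM≤largest f {k@(suc (suc _))} _ =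
  subst (_≤ largest ([_] ∘ nM f) k) (sym (nM-unfold f k)) (⊓∞≤ _ (f k))

largest≤nM : ∀ f {k} → 2 ≤ k → f k ≡ ⊤⁺ → largest ([_] ∘ nM f) k ≤ nM f k
largest≤nM f {suc zero} (s≤s ())
largest≤nM f {k@(suc (suc _))} _ fk≡⊤ = ≤-reflexive (sym
  (trans (nM-unfold f k) (cong (largest ([_] ∘ nM f) k ⊓∞_) fk≡⊤)))

⟦⟧-beyond : ∀ xs {k} → length xs < k → ⟦ xs ⟧ k ≡ ⊤⁺
⟦⟧-beyond []       {suc k}       _         = refl
⟦⟧-beyond (x ∷ xs) {1}           (s≤s ())
⟦⟧-beyond (x ∷ xs) {suc (suc k)} (s≤s len) = ⟦⟧-beyond xs len

-- The threshold for `N₁`.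

-- Condition (v) for one part says that the other part is attained at a smaller index. A gap of the
-- sum passes to one of the parts, where the induction hypothesis forbids this. At `k = 6` the gap 9
-- is not inherited but comes from the cap.
N₁-upper : ∀ k → 1 ≤ k → ∀ q → Gap (k + q) q → N₁ k < k + q
N₁-upper = <-rec _ step
  where
  Upper : ℕ → Set
  Upper k = 1 ≤ k → ∀ q → Gap (k + q) q → N₁ k < k + q

  refute : ∀ {k q e e′} → (∀ {j} → j < k → Upper j) → 2 ≤ e → e ≤ k →
           e + e′ ≡ k + suc q → k + suc q ≤ N₁ (k ∸ e + 1) + e → ¬ Gap e′ q
  refute {k} {q} {e} {e′} ih 2≤e e≤k sum m≤ gap = <⇒≱
    (ih (k∸e+1<k 2≤e e≤k) (m≤n+m 1 _) q (subst (λ s → Gap s q) (sym j+q≡e′) gap))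
    (+-cancelʳ-≤ e _ _ (subst (_≤ N₁ (k ∸ e + 1) + e)
      (trans (sym sum) (trans (+-comm e e′) (cong (_+ e) (sym j+q≡e′)))) m≤))
    where
    j+q≡e′ : k ∸ e + 1 + q ≡ e′
    j+q≡e′ = complement e≤k sum

  no-pdp : ∀ {k} → k ≢ 6 → (∀ {j} → j < k → Upper j) → ∀ q → Gap (k + suc q) (suc q) →
           ¬ Satisfiable (pdp ([_] ∘ N₁) k (k + suc q))
  no-pdp {k} k≢6 ih q gap
    ((e₀ , e₁) , (2≤e₀ , 2≤e₁) , (e₀≤k , e₁≤k) , sum , e₀≤e₁ , [ m≤₀ ] , [ m≤₁ ])
    with Gap-split {e₀} {e₁} {q} e₀≤e₁
           (λ { refl s≡9 → k≢6 (+-cancelʳ-≡ 3 k 6 (trans (sym sum) s≡9)) })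
           (subst (λ s → Gap s (suc q)) (sym sum) gap)
  ... | inj₁ gap₀ = refute ih 2≤e₁ e₁≤k (trans (+-comm e₁ e₀) sum) m≤₁ gap₀
  ... | inj₂ gap₁ = refute ih 2≤e₀ e₀≤k sum m≤₀ gap₁

  gap⇒2≤q : ∀ {k q} → 1 ≤ k → Gap (k + q) q → 2 ≤ q
  gap⇒2≤q {suc k} {0} _ (inj₁ (s≤s ()))
  gap⇒2≤q {suc k} {1} _ (inj₁ s<2) rewrite +-comm k 1 = contradiction s<2 λ { (s≤s (s≤s ())) }
  gap⇒2≤q {suc k} {1} _ (inj₂ (s≤s () , _))
  gap⇒2≤q {q = suc (suc q)} _ _ = s≤s (s≤s z≤n)

  gap⇒3≤q : ∀ {k q} → 2 ≤ k → Gap (k + q) q → 3 ≤ q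
  gap⇒3≤q {k} {q} 2≤k gap = ≤∧≢⇒< (gap⇒2≤q (≤-trans (n≤1+n 1) 2≤k) gap)
    λ { refl → two gap }
    where
    two : ¬ Gap (k + 2) 2
    two (inj₁ s<4)             = <⇒≱ s<4 (+-monoˡ-≤ 2 2≤k)
    two (inj₂ (s≤s (s≤s ()) , _))

  step : ∀ k → (∀ {j} → j < k → Upper j) → Upper k
  step k ih 1≤k q gap with k ≟ 1 | k ≟ 6
  ... | yes refl | _        = s≤s (gap⇒2≤q ≤-refl gap)
  -- `N₁ 6` evaluates to 8, so an excess of 3 is already out of reach.
  ... | no  _    | yes refl = +-monoʳ-≤ 6 (gap⇒3≤q (s≤s (s≤s z≤n)) gap)
  ... | no  k≢1  | no  k≢6  = ≤-<-trans (nM≤largest ⟦ caps ⟧ 2≤k)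
    -- The default 4 of `largest` must lie below `k + q` too, which is at least `2 + 3`.
    (largest< (+-mono-≤ 2≤k (gap⇒3≤q 2≤k gap)) below)
    where
    2≤k : 2 ≤ k
    2≤k = ≤∧≢⇒< 1≤k (k≢1 ∘ sym)

    below : ∀ {m} → Satisfiable (pdp ([_] ∘ N₁) k m) → m < k + q
    -- Every sum from `k + q` on must be excluded; it is `k + q′` with `q ≤ q′`, and `Gap-≤` carries
    -- the gap there.
    below {m} sat = ≰⇒> λ k+q≤m →
      let k≤m    = ≤-trans (m≤m+n k q) k+q≤m
          q≤m∸k  = m+n≤o⇒m≤o∸n q (subst (_≤ m) (+-comm k q) k+q≤m)
      in absurd (m ∸ k) q≤m∸k (m+[n∸m]≡n k≤m)
      where
      absurd : ∀ q′ → q ≤ q′ → k + q′ ≢ m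
      absurd zero     q≤q′ _    = contradiction (≤-trans (gap⇒2≤q 1≤k gap) q≤q′) λ ()
      absurd (suc q′) q≤q′ refl = no-pdp k≢6 ih q′ (Gap-≤ {k} q≤q′ gap) sat

-- The splitting with `e₀ = 2 ^ q` serves again, but now both parts must be attained. The part `e₁`
-- avoids `1 + 2 ^ q` because the sum avoids `1 + 2 ^ suc q`.
N₁-lower : ∀ k q → 2 ^ q ≤ k + q → k + q ≢ 1 + 2 ^ q → k + q ≤ N₁ k
N₁-lower = <-rec _ step
  where
  Lower : ℕ → Set
  Lower k = ∀ q → 2 ^ q ≤ k + q → k + q ≢ 1 + 2 ^ q → k + q ≤ N₁ k

  small : ∀ {k} → k < 7 → Lower k
  small {k} k<7 q le = table k<7 q<4 le
    where
    table : ∀ {k} → k < 7 → ∀ {q} → q < 4 → 2 ^ q ≤ k + q → k + q ≢ 1 + 2 ^ q → k + q ≤ N₁ k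
    -- In the range of the caps the bound is checked by evaluation. It is a finite check, as
    -- `6 + q < 2 ^ q` from `q = 4` on.
    table = from-yes (allUpTo? (λ k → allUpTo? (λ q →
      (2 ^ q ≤? k + q) →-dec (¬? (k + q ≟ 1 + 2 ^ q) →-dec (k + q ≤? N₁ k))) 4) 7)
    q<4 : q < 4
    q<4 = ≰⇒> λ 4≤q → <⇒≱ (subst₂ _<_ (rearrange 4≤q) (cong (2 ^_) (m∸n+n≡m 4≤q))
            (m<2^n⇒o+m<2^[o+n] 4 (q ∸ 4) (m≤m+n 11 5)))
          (≤-trans le (+-monoˡ-≤ q (≤-pred k<7)))
      where
      rearrange : 4 ≤ q → q ∸ 4 + 10 ≡ 6 + q
      rearrange 4≤q = trans (sym (+-assoc (q ∸ 4) 4 6))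
        (trans (cong (_+ 6) (m∸n+n≡m 4≤q)) (+-comm q 6))

  large : ∀ {k} → 7 ≤ k → (∀ {j} → j < k → Lower j) → ∀ r →
          2 ^ (2 + r) ≤ k + (2 + r) → k + (2 + r) ≢ 1 + 2 ^ (2 + r) → k + (2 + r) ≤ N₁ k
  large {k} 7≤k ih r le ≢gap = ≤-trans
    (≤largest (+-mono-≤ 2≤k (m≤m+n 2 r))
      (subst₂ _≤_ sum (cong (k +_) (sym (+-identityʳ k))) (+-mono-≤ e₀≤k e₁≤k))
      ((e₀ , e₁) , (2≤e₀ , ≤-trans 2≤e₀ e₀≤e₁) , (e₀≤k , e₁≤k) , sum , e₀≤e₁ ,
       [ bound 2≤e₀ e₀≤k sum e₀≤e₁ e₁≢ ] ,
       [ bound (≤-trans 2≤e₀ e₀≤e₁) e₁≤k (trans (+-comm e₁ e₀) sum) ≤-refl (<⇒≢ (n<1+n e₀)) ]))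
    (largest≤nM ⟦ caps ⟧ 2≤k (⟦⟧-beyond caps 7≤k))
    where
    q = suc r
    e₀ = 2 ^ q
    e₁ = k + suc q ∸ e₀
    2≤k : 2 ≤ k
    2≤k = ≤-trans (s≤s (s≤s z≤n)) 7≤k
    2e₀≤ : e₀ + e₀ ≤ k + suc q
    2e₀≤ = subst (_≤ k + suc q) (2^[1+n]≡2^n+2^n q) le
    sum : e₀ + e₁ ≡ k + suc q
    sum = m+[n∸m]≡n (≤-trans (m≤m+n e₀ e₀) 2e₀≤)
    e₀≤e₁ : e₀ ≤ e₁
    e₀≤e₁ = +-cancelˡ-≤ e₀ e₀ e₁ (subst (e₀ + e₀ ≤_) (sym sum) 2e₀≤)
    e₁≤k : e₁ ≤ k
    e₁≤k = m≤n+o⇒m∸n≤o (k + suc q) e₀ (k+1+q≤2^q+k k q)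
    e₀≤k : e₀ ≤ k
    e₀≤k = ≤-trans e₀≤e₁ e₁≤k
    2≤e₀ : 2 ≤ e₀
    2≤e₀ = ^-monoʳ-≤ 2 (s≤s (z≤n {r}))
    e₁≢ : e₁ ≢ 1 + 2 ^ q
    e₁≢ e₁≡ = ≢gap (trans (sym sum) (trans (cong (e₀ +_) e₁≡)
      (trans (+-suc e₀ e₀) (cong suc (sym (2^[1+n]≡2^n+2^n q))))))
    bound : ∀ {e e′} → 2 ≤ e → e ≤ k → e + e′ ≡ k + suc q → 2 ^ q ≤ e′ → e′ ≢ 1 + 2 ^ q →
            k + suc q ≤ N₁ (k ∸ e + 1) + e
    bound {e} {e′} 2≤e e≤k sum le ≢gap = subst (_≤ N₁ (k ∸ e + 1) + e)
      (trans (+-comm e′ e) sum)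
      (+-monoˡ-≤ e (subst (_≤ N₁ (k ∸ e + 1)) j+q≡e′
        (ih (k∸e+1<k 2≤e e≤k) q (subst (2 ^ q ≤_) (sym j+q≡e′) le)
          (subst (_≢ 1 + 2 ^ q) (sym j+q≡e′) ≢gap))))
      where
      j+q≡e′ : k ∸ e + 1 + q ≡ e′
      j+q≡e′ = complement e≤k sum

  step : ∀ k → (∀ {j} → j < k → Lower j) → Lower k
  step k ih q le ≢gap with k <? 7
  ... | yes k<7 = small k<7 q le ≢gap
  ... | no  k≮7 = positive q le ≢gap
    where
    7≤k : 7 ≤ k
    7≤k = ≮⇒≥ k≮7
    -- Condition (i) requires `2 ≤ e₀`, so `large` starts at excess 2; excesses 0 and 1 follow from
    -- it. The exceptional sum there is 5, below `k + 2`.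
    two : k + 2 ≤ N₁ k
    two = large 7≤k ih 0 (≤-trans (m≤m+n 4 5) (+-monoˡ-≤ 2 7≤k))
      (λ k+2≡5 → <⇒≱ (subst (_< 9) (sym k+2≡5) (m≤m+n 6 3)) (+-monoˡ-≤ 2 7≤k))
    positive : Lower k
    positive 0             _  _    = ≤-trans (+-monoʳ-≤ k z≤n) two
    positive 1             _  _    = ≤-trans (+-monoʳ-≤ k (n≤1+n 1)) two
    positive (suc (suc r)) le ≢gap = large 7≤k ih r le ≢gap

-- Comparison of `N₁` with `N`.

N≡k+p : ∀ {k} → 1 ≤ k → ∃[ p ] N k ≡ k + p × 2 ^ p ≤ k + p
N≡k+p {k} 1≤k = N k ∸ k , sym k+p≡N , ≮⇒≥ λ gap → <⇒≢ (N-upper k 1≤k _ gap) (sym k+p≡N)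
  where
  k+p≡N : k + (N k ∸ k) ≡ N k
  k+p≡N = m+[n∸m]≡n (subst (_≤ N k) (+-identityʳ k)
    (N-lower k 1≤k 0 (≤-trans 1≤k (m≤m+n k 0))))

-- The excess after that of `N k` must miss its power of two, by `N-lower`, and this is a gap for
-- `N₁` as well.
N₁≤N : ∀ {k} → 1 ≤ k → N₁ k ≤ N k
N₁≤N {k} 1≤k with N≡k+p 1≤k
... | p , N≡ , _ with 2 ^ suc p ≤? k + suc p
...   | yes le = contradiction (subst (k + suc p ≤_) N≡ (N-lower k 1≤k (suc p) le))
                   (<⇒≱ (+-monoʳ-< k ≤-refl))
...   | no ¬le = ≤-pred (subst (N₁ k <_) (trans (+-suc k p) (cong suc (sym N≡)))
                   (N₁-upper k 1≤k (suc p) (inj₁ (≰⇒> ¬le))))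

2^m∸m+1+m≡1+2^m : ∀ m → 2 ^ m ∸ m + 1 + m ≡ 1 + 2 ^ m
2^m∸m+1+m≡1+2^m m = trans (cong (_+ m) (+-comm (2 ^ m ∸ m) 1))
  (cong suc (m∸n+n≡m (<⇒≤ (n<2^n m))))

-- The excess of `N k` is also reached by `N₁` unless `k + p` is `1 + 2 ^ p`. Solving for `k` gives
-- an excluded index when `3 ≤ p`.
N≤N₁ : ∀ {k} → 1 ≤ k → ¬ (∃[ m ] 3 ≤ m × k ≡ 2 ^ m ∸ m + 1) → N k ≤ N₁ k
N≤N₁ {k} 1≤k regular with N≡k+p 1≤k
... | p , N≡ , le with k + p ≟ 1 + 2 ^ p
...   | no  ≢gap = subst (_≤ N₁ k) (sym N≡) (N₁-lower k p le ≢gap)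
...   | yes ≡gap = degenerate p (λ 3≤p → regular (p , 3≤p , k≡)) k≡
  where
  k≡ : k ≡ 2 ^ p ∸ p + 1
  k≡ = +-cancelʳ-≡ p k _ (trans ≡gap (sym (2^m∸m+1+m≡1+2^m p)))
  degenerate : ∀ {k} p → ¬ 3 ≤ p → k ≡ 2 ^ p ∸ p + 1 → N k ≤ N₁ k
  -- Here `k` is 2, 2 and 3, and the values are compared by evaluation.
  degenerate 0 _ refl = ≤-refl
  degenerate 1 _ refl = ≤-refl
  degenerate 2 _ refl = ≤-refl
  degenerate (suc (suc (suc p))) p<3 _ = contradiction (m≤m+n 3 p) p<3

N-exceptional : ∀ {k m} → 1 ≤ k → 3 ≤ m → k + m ≡ 1 + 2 ^ m → N k ≡ 1 + 2 ^ m
N-exceptional {k} {m} 1≤k 3≤m k+m≡ = ≤-antisym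
  (≤-pred (subst (N k <_) k+1+m≡
    (N-upper k 1≤k (suc m) (subst (_< 2 ^ suc m) (sym k+1+m≡) (2+2^n<2^[1+n] 3≤m)))))
  (subst (_≤ N k) k+m≡ (N-lower k 1≤k m (subst (2 ^ m ≤_) (sym k+m≡) (n≤1+n (2 ^ m)))))
  where
  k+1+m≡ : k + suc m ≡ 2 + 2 ^ m
  k+1+m≡ = trans (+-suc k m) (cong suc k+m≡)

-- Excess `m` meets the exceptional gap. Excess `r`, one less, has sum `2 ^ m`, which exceeds
-- `1 + 2 ^ r` and so is attained.
N₁-exceptional : ∀ {k m} → 1 ≤ k → 3 ≤ m → k + m ≡ 1 + 2 ^ m → N₁ k ≡ 2 ^ m
N₁-exceptional {k} {m@(suc r)} 1≤k 3≤m@(s≤s 2≤r) k+m≡ = ≤-antisym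
  (≤-pred (subst (N₁ k <_) k+m≡ (N₁-upper k 1≤k m (inj₂ (3≤m , k+m≡)))))
  (subst (_≤ N₁ k) k+r≡ (N₁-lower k r
    (subst (2 ^ r ≤_) (sym k+r≡) (≤-trans (n≤1+n (2 ^ r)) (<⇒≤ 1+2^r<2^m)))
    (λ k+r≡1+2^r → <⇒≢ 1+2^r<2^m (trans (sym k+r≡1+2^r) k+r≡))))
  where
  k+r≡ : k + r ≡ 2 ^ m
  k+r≡ = suc-injective (trans (sym (+-suc k r)) k+m≡)
  1+2^r<2^m : 1 + 2 ^ r < 2 ^ m
  1+2^r<2^m = subst (1 + 2 ^ r <_) (sym (2^[1+n]≡2^n+2^n r))
    (+-monoˡ-< (2 ^ r) (≤-trans (m≤m+n 2 2) (^-monoʳ-≤ 2 2≤r)))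

theorem14p7 : let N₁ = nM ⟦ 2 ∷ 4 ∷ 5 ∷ 6 ∷ 8 ∷ 8 ∷ [] ⟧ in
    (∀ k → 1 ≤ k → ¬ (∃[ m ] 3 ≤ m × k ≡ 2 ^ m ∸ m + 1) → N₁ k ≡ N k)
    × (∀ k m → 3 ≤ m → k ≡ 2 ^ m ∸ m + 1 → N₁ k ≡ N k ∸ 1 × N k ∸ 1 ≡ 2 ^ m)
theorem14p7 =
  (λ k 1≤k regular → ≤-antisym (N₁≤N 1≤k) (N≤N₁ 1≤k regular)) , exceptional
  where
  exceptional : ∀ k m → 3 ≤ m → k ≡ 2 ^ m ∸ m + 1 → N₁ k ≡ N k ∸ 1 × N k ∸ 1 ≡ 2 ^ m
  exceptional k m 3≤m refl = trans (N₁-exceptional 1≤k 3≤m k+m≡) (sym N∸1≡) , N∸1≡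
    where
    k+m≡ : k + m ≡ 1 + 2 ^ m
    k+m≡ = 2^m∸m+1+m≡1+2^m m
    1≤k : 1 ≤ k
    1≤k = m≤n+m 1 (2 ^ m ∸ m)
    N∸1≡ : N k ∸ 1 ≡ 2 ^ m
    N∸1≡ = cong (_∸ 1) (N-exceptional 1≤k 3≤m k+m≡)
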